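{- For all even integers $a, b \ge 2$, $R_\mathrm{ord}(M_a^\mathrm{nest}, M_b^\mathrm{nest}) = a + b - 2$.
   Context: All graphs are finite, simple and undirected, and a graph of order $n$ has vertex set $\{0,1,\ldots,n-1\}$; $K_n$ is the complete graph on $\{0,\ldots,n-1\}$. A $2$-edge-coloring of $K_n$ assigns each edge a color in $\{1,2\}$. For a graph $H$ and such a coloring, an embedding of $H$ in color $j$ is an injective map $\varphi\colon V(H)\to V(K_n)$ such that for every edge $uv$ of $H$ the edge $\{\varphi(u),\varphi(v)\}$ has color $j$; it is increasing if $\varphi(0)<\cdots<\varphi(|H|-1)$. The ordered Ramsey number $R_\mathrm{ord}(H_1,H_2)$ is the smallest $n$ such that every $2$-edge-coloring of $K_n$ admits an increasing embedding of $H_1$ in color $1$ or an increasing embedding of $H_2$ in color $2$. For even $n\ge2$, the nested matching $M_n^\mathrm{nest}$ is the graph of order $n$ whose edges are exactly $\{v, n-1-v\}$ for $0\le v\le n/2-1$. -}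

module Defs where

open import Data.Fin using (Fin; toℕ) renaming (_<_ to _<ᶠ_)
open import Data.Fin.Properties using () renaming (_≟_ to _≟ᶠ_)
open import Data.Nat using (ℕ; suc; _+_; _*_; _∸_; _≤_; _<_)
open import Data.Nat.DivMod using (_/_; m/n*n≤m)
open import Data.Nat.Properties
open import Data.Product using (Σ; _×_; _,_)
open import Data.Sum using (_⊎_; inj₁; inj₂; swap; [_,_])
open import Function.Definitions using (Injective)
open import Relation.Binary.Definitions using (Decidable; Symmetric)
open import Relation.Binary.PropositionalEquality using (_≡_; _≢_; refl; sym; cong; ≢-sym)
open import Relation.Nullary using (¬_)
open import Relation.Nullary.Decidable using (_×-dec_; _⊎-dec_; ¬?)

record Graph (n : ℕ) : Set₁ where
  field
    Adj    : Fin n → Fin n → Set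
    adj?   : Decidable Adj
    symm   : Symmetric Adj
    irrefl : ∀ {v} → ¬ Adj v v

open Graph public

K : (n : ℕ) → Graph n
K n = record
  { Adj    = _≢_
  ; adj?   = λ u v → ¬? (u ≟ᶠ v)
  ; symm   = ≢-sym
  ; irrefl = λ v≢v → v≢v refl
  }

data Color : Set where
  color₁ color₂ : Color

-- The adjacency proof is irrelevant and `color-symm` identifies the two
-- orientations, so this is a function on the unordered edges {u , v} of K n.
record Coloring (n : ℕ) : Set where
  field
    color      : (u v : Fin n) → .(Adj (K n) u v) → Color
    color-symm : (u v : Fin n) (e : Adj (K n) u v) →
                 color u v e ≡ color v u (symm (K n) e)

open Coloring public

injective⇒adj : ∀ {m n} (H : Graph m) {f : Fin m → Fin n} → Injective _≡_ _≡_ f →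
                ∀ {u v} → Adj H u v → Adj (K n) (f u) (f v)
injective⇒adj H inj e fu≡fv with inj fu≡fv
... | refl = irrefl H e

record Embedding {m n : ℕ} (H : Graph m) (c : Coloring n) (j : Color) : Set where
  field
    map       : Fin m → Fin n
    injective : Injective _≡_ _≡_ map
    map-color : ∀ {u v} (e : Adj H u v) →
                color c (map u) (map v) (injective⇒adj H injective e) ≡ j

open Embedding public

Increasing : ∀ {m n} {H : Graph m} {c : Coloring n} {j : Color} → Embedding H c j → Set
Increasing φ = ∀ {u v} → u <ᶠ v → map φ u <ᶠ map φ v

IncreasingEmbedding : ∀ {m n} → Graph m → Coloring n → Color → Set
IncreasingEmbedding H c j = Σ (Embedding H c j) Increasing

OrdArrows : ∀ {m₁ m₂} → ℕ → Graph m₁ → Graph m₂ → Set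
OrdArrows n H₁ H₂ = (c : Coloring n) →
  IncreasingEmbedding H₁ c color₁ ⊎ IncreasingEmbedding H₂ c color₂

-- R_ord(H₁ , H₂) = r, as a relation: r is the least n with OrdArrows n H₁ H₂.
R-ord[_,_]≡_ : ∀ {m₁ m₂} → Graph m₁ → Graph m₂ → ℕ → Set
R-ord[ H₁ , H₂ ]≡ r = OrdArrows r H₁ H₂ × (∀ n → OrdArrows n H₁ H₂ → r ≤ n)

NestPair : (n : ℕ) → Fin n → Fin n → Set
NestPair n u v = toℕ u < n / 2 × toℕ v ≡ n ∸ 1 ∸ toℕ u

nestPair-irrefl : ∀ n (v : Fin n) → ¬ NestPair n v v
nestPair-irrefl (suc k) v (v<h , v≡k∸v) = <-irrefl refl (begin-strict
  k                 ≤⟨ m≤n+m∸n k x ⟩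
  x + (k ∸ x)       ≡⟨ cong (x +_) (sym v≡k∸v) ⟩
  x + x             ≡⟨ cong (x +_) (sym (+-identityʳ x)) ⟩
  2 * x             ≡⟨ *-comm 2 x ⟩
  x * 2             <⟨ n<1+n (x * 2) ⟩
  suc (x * 2)       ≤⟨ ≤-pred (≤-trans (*-monoˡ-≤ 2 v<h) (m/n*n≤m (suc k) 2)) ⟩
  k                 ∎)
  where
  open ≤-Reasoning
  x = toℕ v

-- Total in n; it is the nested matching for even n ≥ 2 (for odd n the middle
-- vertex is isolated).
nestedMatching : (n : ℕ) → Graph n
nestedMatching n = record
  { Adj    = λ u v → NestPair n u v ⊎ NestPair n v u
  ; adj?   = λ u v → pair? u v ⊎-dec pair? v u
  ; symm   = swap
  ; irrefl = λ {v} → [ nestPair-irrefl n v , nestPair-irrefl n v ]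
  }
  where
  pair? : Decidable (NestPair n)
  pair? u v = (toℕ u <? n / 2) ×-dec (toℕ v ≟ n ∸ 1 ∸ toℕ u)

{-# OPTIONS --safe #-}
-- Upper bound: the pairs {i , n-1-i} of K n, with n = a + b - 2, form
-- a/2 + b/2 - 1 nested edges, so a/2 of them have color 1 or b/2 have color 2.
-- Lower bound: give {u , v} color 1 iff |u - v| ≥ b - 1.  The outermost edge of
-- an increasing copy of the nested matching of order b spans at least b - 1, so
-- it cannot have color 2; the innermost edge of a copy of the nested matching of
-- order a in color 1 spans at least b - 1 and has a/2 - 1 further vertices on
-- each side, so such a copy needs at least a + b - 2 vertices.
module Submission where

open import Data.Fin using (Fin; toℕ; zero; suc; fromℕ<; inject≤; opposite) renaming (_<_ to _<ᶠ_)
open import Data.Fin.Properties using (toℕ-injective; toℕ-fromℕ<; toℕ-inject≤; toℕ<n; opposite-prop; opposite-involutive) renaming (<-cmp to <ᶠ-cmp)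
open import Data.Nat using (ℕ; zero; suc; _+_; _*_; _∸_; _≤_; _<_; _<?_; _≤?_; s≤s; z<s; s<s; s<s⁻¹; ∣_-_∣)
open import Data.Nat.DivMod using (m*n/n≡m)
open import Data.Nat.Divisibility using (_∣_; divides)
open import Data.Nat.Properties
open import Data.Product using (Σ; _×_; _,_)
open import Data.Sum using (_⊎_; inj₁; inj₂)
import Data.Sum as Sum
open import Function.Definitions using (Injective)
open import Relation.Binary.Definitions using (tri<; tri≈; tri>)
open import Relation.Binary.PropositionalEquality using (_≡_; _≢_; refl; sym; trans; cong; subst; subst₂)
open import Relation.Nullary using (¬_; yes; no; contradiction)
open import Defs

-- Strictly increasing maps and their gaps.

m*2≡m+m : ∀ m → m * 2 ≡ m + m
m*2≡m+m m = trans (*-comm m 2) (cong (m +_) (+-identityʳ m))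

StrictMono : ∀ {m n} → (Fin m → Fin n) → Set
StrictMono f = ∀ {u v} → u <ᶠ v → f u <ᶠ f v

strictMono⇒injective : ∀ {m n} {f : Fin m → Fin n} → StrictMono f → Injective _≡_ _≡_ f
strictMono⇒injective mono {u} {v} fu≡fv with <ᶠ-cmp u v
... | tri< u<v _ _ = contradiction (cong toℕ fu≡fv) (<⇒≢ (mono u<v))
... | tri≈ _ u≡v _ = u≡v
... | tri> _ _ v<u = contradiction (cong toℕ (sym fu≡fv)) (<⇒≢ (mono v<u))

-- Values are natural numbers, so each step up in the domain raises the value by at least one. The
-- induction peels steps off at the top: `w` is the vertex just below `v`.
strictMono-gap : ∀ {m n} {f : Fin m → Fin n} → StrictMono f →
                 ∀ k {u v} → toℕ u + k ≡ toℕ v → toℕ (f u) + k ≤ toℕ (f v)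
strictMono-gap {f = f} mono zero {u} {v} eq
  with refl ← toℕ-injective {i = u} {j = v} (trans (sym (+-identityʳ _)) eq) =
  ≤-reflexive (+-identityʳ _)
strictMono-gap {m} {f = f} mono (suc k) {u} {v} eq = begin
  toℕ (f u) + suc k    ≡⟨ +-suc _ k ⟩
  suc (toℕ (f u) + k)  ≤⟨ s≤s (strictMono-gap mono k (sym (toℕ-fromℕ< w<m))) ⟩
  suc (toℕ (f w))      ≤⟨ mono (subst (_< toℕ v) (sym (toℕ-fromℕ< w<m)) w<v) ⟩
  toℕ (f v)            ∎
  where
  open ≤-Reasoning
  w<v : toℕ u + k < toℕ v
  w<v = ≤-reflexive (trans (sym (+-suc _ k)) eq)
  w<m : toℕ u + k < m
  w<m = <-trans w<v (toℕ<n v)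
  w : Fin m
  w = fromℕ< w<m

-- Monochromatic selections.

Selection : ∀ {m} → (Fin m → Color) → Color → ℕ → Set
Selection {m} f j k = Σ (Fin k → Fin m) λ g → StrictMono g × (∀ i → f (g i) ≡ j)

skip : ∀ {m k j} (f : Fin (suc m) → Color) → Selection (λ i → f (suc i)) j k → Selection f j k
skip f (g , mono , col) = (λ i → suc (g i)) , (λ u<v → s<s (mono u<v)) , col

take : ∀ {m k j} (f : Fin (suc m) → Color) → f zero ≡ j →
       Selection (λ i → f (suc i)) j k → Selection f j (suc k)
take {m} {k} {j} f f0≡j (g , mono , col) = g′ , (λ {u} {v} → mono′ {u} {v}) , col′
  where
  g′ : Fin (suc k) → Fin (suc m)
  g′ zero    = zero
  g′ (suc i) = suc (g i)
  mono′ : StrictMono g′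
  mono′ {zero}  {suc v} _   = z<s
  mono′ {suc u} {suc v} u<v = s<s (mono (s<s⁻¹ u<v))
  col′ : ∀ i → f (g′ i) ≡ j
  col′ zero    = f0≡j
  col′ (suc i) = col i

none : ∀ {m j} (f : Fin m → Color) → Selection f j 0
none f = (λ ()) , (λ { {()} }) , λ ()

-- Induction on `m`: the first element is spent on its own color and lowers that target by one,
-- while a selection in the other color skips it. The bound is `suc m` because `p - 1` elements of
-- one color and `q - 1` of the other are the most that avoid both outcomes.
pigeonhole : ∀ m (f : Fin m → Color) p q → p + q ≤ suc m →
             Selection f color₁ p ⊎ Selection f color₂ q
pigeonhole m       f zero    q       _  = inj₁ (none f)
pigeonhole m       f (suc p) zero    _  = inj₂ (none f)
pigeonhole zero    f (suc p) (suc q) le =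
  contradiction (≤-trans (≤-reflexive (sym (+-suc p q))) (≤-pred le)) λ ()
pigeonhole (suc m) f (suc p) (suc q) le with f zero in eq
... | color₁ = Sum.map (take f eq) (skip f) (pigeonhole m (λ i → f (suc i)) p (suc q) (≤-pred le))
... | color₂ = Sum.map (skip f) (take f eq) (pigeonhole m (λ i → f (suc i)) (suc p) q
                 (≤-trans (≤-reflexive (sym (+-suc p q))) (≤-pred le)))

-- Mirror symmetry of `Fin (m * 2)`.

-- The two ends of the `i`-th edge of the nested matching, counted from the outside.
low high : ∀ {m} → Fin m → Fin (m * 2)
low {m} i = inject≤ i (m≤m*n m 2)
high i = opposite (low i)

toℕ-low : ∀ {m} (i : Fin m) → toℕ (low i) ≡ toℕ i
toℕ-low {m} i = toℕ-inject≤ i (m≤m*n m 2)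

low-mono : ∀ {m} → StrictMono (low {m})
low-mono {u = u} {v} = subst₂ _<_ (sym (toℕ-low u)) (sym (toℕ-low v))

low-cancel : ∀ {m} {i j : Fin m} → low i <ᶠ low j → i <ᶠ j
low-cancel {i = i} {j} = subst₂ _<_ (toℕ-low i) (toℕ-low j)

opposite-anti : ∀ {n} {u v : Fin n} → u <ᶠ v → opposite v <ᶠ opposite u
opposite-anti {n} {u} {v} u<v = subst₂ _<_ (sym (opposite-prop v)) (sym (opposite-prop u))
  (∸-monoʳ-< (s<s u<v) (toℕ<n v))

opposite-cancel : ∀ {n} {u v : Fin n} → opposite v <ᶠ opposite u → u <ᶠ v
opposite-cancel {u = u} {v} lt =
  subst₂ _<ᶠ_ (opposite-involutive u) (opposite-involutive v) (opposite-anti lt)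

low<high : ∀ {m} (i j : Fin m) → low i <ᶠ high j
low<high {m} i j = begin-strict
  toℕ (low i)                 ≡⟨ toℕ-low i ⟩
  toℕ i                       <⟨ toℕ<n i ⟩
  m                           ≡⟨ m+n∸n≡m m m ⟨
  m + m ∸ m                   ≤⟨ ∸-monoʳ-≤ (m + m) (toℕ<n j) ⟩
  m + m ∸ suc (toℕ j)         ≡⟨ cong (_∸ suc (toℕ j)) (m*2≡m+m m) ⟨
  m * 2 ∸ suc (toℕ j)         ≡⟨ cong (λ x → m * 2 ∸ suc x) (toℕ-low j) ⟨
  m * 2 ∸ suc (toℕ (low j))   ≡⟨ opposite-prop (low j) ⟨
  toℕ (high j)                ∎
  where open ≤-Reasoning

low≢high : ∀ {m} (i j : Fin m) → low i ≢ high j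
low≢high i j eq = <⇒≢ (low<high i j) (cong toℕ eq)

data Half {p} : Fin (p * 2) → Set where
  isLow  : (i : Fin p) → Half (low i)
  isHigh : (i : Fin p) → Half (high i)

half-low : ∀ {p} {u : Fin (p * 2)} → (u<p : toℕ u < p) → low (fromℕ< u<p) ≡ u
half-low u<p = toℕ-injective (trans (toℕ-low (fromℕ< u<p)) (toℕ-fromℕ< u<p))

half : ∀ {p} (u : Fin (p * 2)) → Half {p} u
half {p} u with toℕ u <? p
... | yes u<p = subst Half (half-low u<p) (isLow (fromℕ< u<p))
... | no  u≮p = subst Half (trans (cong opposite (half-low u′<p)) (opposite-involutive u))
                  (isHigh (fromℕ< u′<p))
  where
  open ≤-Reasoning
  -- `opposite u` and `u` sum to one less than `p + p`, so `p ≤ u` forces `opposite u` below `p`.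
  u′<p : toℕ (opposite u) < p
  u′<p = +-cancelʳ-< p _ p (begin-strict
    toℕ (opposite u) + p            ≤⟨ +-monoʳ-≤ (toℕ (opposite u)) (≮⇒≥ u≮p) ⟩
    toℕ (opposite u) + toℕ u        <⟨ +-monoʳ-< (toℕ (opposite u)) (n<1+n (toℕ u)) ⟩
    toℕ (opposite u) + suc (toℕ u)  ≡⟨ cong (_+ suc (toℕ u)) (opposite-prop u) ⟩
    p * 2 ∸ suc (toℕ u) + suc (toℕ u) ≡⟨ m∸n+n≡m (toℕ<n u) ⟩
    p * 2                           ≡⟨ m*2≡m+m p ⟩
    p + p                           ∎)

nestPair⇒opposite : ∀ {n} {u v : Fin n} → NestPair n u v → v ≡ opposite u
nestPair⇒opposite {n} {u} (_ , v≡) = toℕ-injective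
  (trans v≡ (trans (∸-+-assoc n 1 (toℕ u)) (sym (opposite-prop u))))

nestPair⇒lowHigh : ∀ {p} {u v : Fin (p * 2)} → NestPair (p * 2) u v →
                   Σ (Fin p) λ i → u ≡ low i × v ≡ high i
nestPair⇒lowHigh {p} {u} e@(u<h , _) =
  fromℕ< u<p , sym (half-low u<p) , trans (nestPair⇒opposite e) (cong opposite (sym (half-low u<p)))
  where
  u<p : toℕ u < p
  u<p = subst (toℕ u <_) (m*n/n≡m p 2) u<h

-- Nested copies from selected mirror edges.

module _ {p m} (g : Fin p → Fin m) (g-mono : StrictMono g) where

  -- Extends `g` symmetrically to both halves, so that edge `i` is sent to edge `g i`. Recursion is
  -- on the view, which lets later proofs match on it without unfolding `half`.
  reflectHalf : ∀ {u : Fin (p * 2)} → Half {p} u → Fin (m * 2)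
  reflectHalf (isLow i)  = low (g i)
  reflectHalf (isHigh i) = high (g i)

  reflectHalf-mono : ∀ {u v} (hu : Half {p} u) (hv : Half {p} v) → u <ᶠ v →
                     reflectHalf hu <ᶠ reflectHalf hv
  reflectHalf-mono (isLow i)  (isLow j)  u<v = low-mono (g-mono (low-cancel u<v))
  reflectHalf-mono (isLow i)  (isHigh j) _   = low<high (g i) (g j)
  reflectHalf-mono (isHigh i) (isLow j)  u<v = contradiction u<v (<-asym (low<high j i))
  reflectHalf-mono (isHigh i) (isHigh j) u<v =
    opposite-anti (low-mono (g-mono (low-cancel (opposite-cancel u<v))))

  reflect : Fin (p * 2) → Fin (m * 2)
  reflect u = reflectHalf (half {p} u)

  reflect-mono : StrictMono reflect
  reflect-mono {u} {v} = reflectHalf-mono (half {p} u) (half {p} v)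

  -- `half (low i)` does not reduce to `isLow i`, hence an arbitrary view and a propositional
  -- equation; injectivity of `low` then identifies the indices.
  reflectHalf-low : ∀ {u} (h : Half {p} u) i → u ≡ low i → reflectHalf h ≡ low (g i)
  reflectHalf-low (isLow j) i eq =
    cong (λ k → low (g k)) (strictMono⇒injective {f = low} low-mono eq)
  reflectHalf-low (isHigh j) i eq = contradiction (sym eq) (low≢high i j)

  reflectHalf-high : ∀ {u} (h : Half {p} u) i → u ≡ high i → reflectHalf h ≡ high (g i)
  reflectHalf-high (isLow j) i eq = contradiction eq (low≢high j i)
  reflectHalf-high (isHigh j) i eq =
    cong (λ k → high (g k)) (strictMono⇒injective {f = low} low-mono
      (trans (sym (opposite-involutive (low j)))
        (trans (cong opposite eq) (opposite-involutive (low i)))))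

color-cong : ∀ {n} (c : Coloring n) {u v x y : Fin n} .(e : u ≢ v) .(e′ : x ≢ y) →
             u ≡ x → v ≡ y → color c u v e ≡ color c x y e′
color-cong c e e′ refl refl = refl

mirrorColor : ∀ {m} → Coloring (m * 2) → Fin m → Color
mirrorColor c i = color c (low i) (high i) (low≢high i i)

-- Any set of mirror edges is pairwise nested, so those chosen by `g` already form an increasing
-- copy, with `reflect` as its vertex map.
selection⇒embedding : ∀ {p m j} (c : Coloring (m * 2)) → Selection (mirrorColor {m} c) j p →
                      IncreasingEmbedding (nestedMatching (p * 2)) c j
selection⇒embedding {p} {m} {j} c (g , g-mono , g-color) = φ , λ {u} {v} → mono {u} {v}
  where
  f : Fin (p * 2) → Fin (m * 2)
  f = reflect g g-mono
  mono : StrictMono f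
  mono {u} {v} = reflect-mono g g-mono {u} {v}
  pair-color : ∀ {u v} → NestPair (p * 2) u v → (e : f u ≢ f v) → color c (f u) (f v) e ≡ j
  pair-color {u} {v} uv e with nestPair⇒lowHigh {p} uv
  ... | i , u≡ , v≡ = trans
    (color-cong c e (low≢high (g i) (g i))
      (reflectHalf-low g g-mono (half {p} u) i u≡) (reflectHalf-high g g-mono (half {p} v) i v≡))
    (g-color i)
  edge-color : ∀ {u v} → Adj (nestedMatching (p * 2)) u v → (e : f u ≢ f v) →
               color c (f u) (f v) e ≡ j
  edge-color (inj₁ uv) e = pair-color uv e
  edge-color {u} {v} (inj₂ vu) e =
    trans (color-symm c (f u) (f v) e) (pair-color vu (λ eq → e (sym eq)))
  φ : Embedding (nestedMatching (p * 2)) c j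
  φ = record
    { map       = f
    ; injective = strictMono⇒injective {f = f} (λ {u} {v} → mono {u} {v})
    ; map-color = λ e → edge-color e
        (injective⇒adj (nestedMatching (p * 2)) (strictMono⇒injective {f = f} (λ {u} {v} → mono {u} {v})) e)
    }

nested-arrows : ∀ p q m → p + q ≤ suc m →
                OrdArrows (m * 2) (nestedMatching (p * 2)) (nestedMatching (q * 2))
nested-arrows p q m le c = Sum.map (selection⇒embedding {p} {m} c) (selection⇒embedding {q} {m} c)
  (pigeonhole m (mirrorColor {m} c) p q le)

-- The coloring by edge length.

lengthColor : ℕ → ℕ → Color
lengthColor ℓ d with ℓ ≤? d
... | yes _ = color₁
... | no  _ = color₂

lengthColor₁⇒≤ : ∀ ℓ d → lengthColor ℓ d ≡ color₁ → ℓ ≤ d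
lengthColor₁⇒≤ ℓ d eq with ℓ ≤? d
... | yes ℓ≤d = ℓ≤d

lengthColor₂⇒≰ : ∀ ℓ d → lengthColor ℓ d ≡ color₂ → ¬ ℓ ≤ d
lengthColor₂⇒≰ ℓ d eq with ℓ ≤? d
... | no ℓ≰d = ℓ≰d

lengthColoring : ℕ → ∀ n → Coloring n
lengthColoring ℓ n = record
  { color      = λ u v _ → lengthColor ℓ ∣ toℕ u - toℕ v ∣
  ; color-symm = λ u v _ → cong (lengthColor ℓ) (∣-∣-comm (toℕ u) (toℕ v))
  }

-- The sum form of the mirror condition avoids truncated subtraction when concrete edges are
-- supplied.
nestPair-fromℕ< : ∀ p {x y} (x<n : x < p * 2) (y<n : y < p * 2) → x < p → suc (x + y) ≡ p * 2 →
                  NestPair (p * 2) (fromℕ< x<n) (fromℕ< y<n)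
nestPair-fromℕ< p {x} {y} x<n y<n x<p eq rewrite toℕ-fromℕ< x<n | toℕ-fromℕ< y<n =
  subst (x <_) (sym (m*n/n≡m p 2)) x<p ,
  trans (sym (m+n∸m≡n x y)) (cong (λ n → n ∸ 1 ∸ x) eq)

m+o≤n⇒o≤∣m-n∣ : ∀ {m n o} → m + o ≤ n → o ≤ ∣ m - n ∣
m+o≤n⇒o≤∣m-n∣ {m} {n} {o} le = begin
  o          ≡⟨ m+n∸m≡n m o ⟨
  m + o ∸ m  ≤⟨ ∸-monoˡ-≤ m le ⟩
  n ∸ m      ≡⟨ m≤n⇒∣m-n∣≡n∸m (m+n≤o⇒m≤o m le) ⟨
  ∣ m - n ∣  ∎
  where open ≤-Reasoning

innermost-long⇒order : ∀ p ℓ n → IncreasingEmbedding (nestedMatching (suc p * 2)) (lengthColoring ℓ n) color₁ →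
                       p * 2 + suc ℓ ≤ n
innermost-long⇒order p ℓ n (φ , mono) = begin
  p * 2 + suc ℓ        ≡⟨ +-suc (p * 2) ℓ ⟩
  suc (p * 2 + ℓ)      ≡⟨ cong (λ x → suc (x + ℓ)) (m*2≡m+m p) ⟩
  suc (p + p + ℓ)      ≡⟨ cong suc (+-assoc p p ℓ) ⟩
  suc (p + (p + ℓ))    ≡⟨ cong suc (+-comm p (p + ℓ)) ⟩
  -- `left` counts the room below `f u`, `middle` the length of the innermost edge, `right` the room
  -- above `f v`. The outer `suc` turns the last position into a number of vertices.
  suc (p + ℓ + p)      ≤⟨ s≤s (+-monoˡ-≤ p (≤-trans (+-monoˡ-≤ ℓ left) middle)) ⟩
  suc (toℕ (f v) + p)  ≤⟨ s≤s right ⟩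
  suc (toℕ (f w))      ≤⟨ toℕ<n (f w) ⟩
  n                    ∎
  where
  open ≤-Reasoning
  N : ℕ
  N = suc p * 2
  f : Fin N → Fin n
  f = map φ
  p≤p*2 : p ≤ p * 2
  p≤p*2 = m≤m*n p 2
  u<N : p < N
  u<N = s≤s (m≤n⇒m≤1+n p≤p*2)
  v<N : suc p < N
  v<N = s≤s (s≤s p≤p*2)
  w<N : suc (p * 2) < N
  w<N = ≤-refl
  -- `u` and `v`, at positions `p` and `suc p`, are the ends of the innermost edge; `w` is the last
  -- vertex.
  u v w : Fin N
  u = fromℕ< u<N
  v = fromℕ< v<N
  w = fromℕ< w<N
  uv : NestPair N u v
  uv = nestPair-fromℕ< (suc p) u<N v<N ≤-refl
    (cong suc (trans (+-suc p p) (cong suc (sym (m*2≡m+m p)))))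
  left : p ≤ toℕ (f u)
  left = m+n≤o⇒n≤o (toℕ (f zero)) (strictMono-gap mono p {zero} {u} (sym (toℕ-fromℕ< u<N)))
  u<v : u <ᶠ v
  u<v = subst₂ _<_ (sym (toℕ-fromℕ< u<N)) (sym (toℕ-fromℕ< v<N)) ≤-refl
  middle : toℕ (f u) + ℓ ≤ toℕ (f v)
  middle = begin
    toℕ (f u) + ℓ                        ≤⟨ +-monoʳ-≤ (toℕ (f u)) (lengthColor₁⇒≤ ℓ _ (map-color φ (inj₁ uv))) ⟩
    toℕ (f u) + ∣ toℕ (f u) - toℕ (f v) ∣ ≡⟨ cong (toℕ (f u) +_) (m≤n⇒∣m-n∣≡n∸m fu≤fv) ⟩
    toℕ (f u) + (toℕ (f v) ∸ toℕ (f u))  ≡⟨ m+[n∸m]≡n fu≤fv ⟩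
    toℕ (f v)                            ∎
    where
    fu≤fv : toℕ (f u) ≤ toℕ (f v)
    fu≤fv = <⇒≤ (mono u<v)
  right : toℕ (f v) + p ≤ toℕ (f w)
  right = strictMono-gap mono p {v} {w}
    (trans (cong (_+ p) (toℕ-fromℕ< v<N)) (trans (cong suc (sym (m*2≡m+m p))) (sym (toℕ-fromℕ< w<N))))

outermost-not-short : ∀ q n → ¬ IncreasingEmbedding (nestedMatching (suc q * 2)) (lengthColoring (suc (q * 2)) n) color₂
outermost-not-short q n (φ , mono) = lengthColor₂⇒≰ ℓ _ (map-color φ (inj₁ zw))
  -- The threshold `ℓ` equals the distance from `zero` to the last vertex `w`, and an increasing map
  -- cannot shrink it.
  (m+o≤n⇒o≤∣m-n∣ (strictMono-gap mono ℓ {zero} {w} (sym (toℕ-fromℕ< w<N))))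
  where
  ℓ : ℕ
  ℓ = suc (q * 2)
  w<N : ℓ < suc q * 2
  w<N = ≤-refl
  w : Fin (suc q * 2)
  w = fromℕ< w<N
  zw : NestPair (suc q * 2) zero w
  zw = nestPair-fromℕ< (suc q) z<s w<N z<s refl

arrows⇒order : ∀ p q n → OrdArrows n (nestedMatching (suc p * 2)) (nestedMatching (suc q * 2)) →
               p * 2 + suc q * 2 ≤ n
arrows⇒order p q n arrows with arrows (lengthColoring (suc (q * 2)) n)
... | inj₁ φ = innermost-long⇒order p (suc (q * 2)) n φ
... | inj₂ φ = contradiction φ (outermost-not-short q n)

theorem4p27 : (a b : ℕ) → 2 ∣ a → 2 ∣ b → 2 ≤ a → 2 ≤ b →
    R-ord[ nestedMatching a , nestedMatching b ]≡ (a + b ∸ 2)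
-- Both quotients are positive since `a` and `b` are at least 2. Then `a + b ∸ 2` computes to
-- `p * 2 + suc q * 2`, that is `(p + suc q) * 2`, and with `m = p + suc q` mirror edges the
-- pigeonhole bound holds with equality.
theorem4p27 _ _ (divides (suc p) refl) (divides (suc q) refl) _ _ =
  subst (λ n → OrdArrows n (nestedMatching (suc p * 2)) (nestedMatching (suc q * 2)))
    (*-distribʳ-+ 2 p (suc q)) (nested-arrows (suc p) (suc q) (p + suc q) ≤-refl) ,
  arrows⇒order p q
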